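{- Let $S$ be the unique formal power series in the variables $t_1,t_2,\dots$ satisfying $S=1+\sum_{n=1}^\infty t_nS^n$, let $S_1=\sum_{n=1}^\infty t_n$, let $G=(S-1)/S_1$, and let $H=G/S$. Then $H$ is the generating function for positive paths, i.e. $H=\sum_P w(P)$, where the sum is over all positive paths $P$ with steps in $\{ -1,0,1,2,\dots\}$ and $w(P)$ is the weight of $P$.
   Context: A path is a finite (possibly empty) sequence $(s_1,\dots,s_k)$ of integers, called its steps; here all steps are in $\{ -1,0,1,2,\dots\}$. A path is positive if every nonempty partial sum $s_1+\cdots+s_i$ ($1\le i\le k$) is positive; in particular the empty path is positive. The weight of a step $n\ge 0$ is $t_{n+1}$, the weight of the step $-1$ is $1$, and the weight $w(P)$ of a path $P$ is the product of the weights of its steps (the empty path has weight $1$). The generating function for a set of paths is the sum of their weights, as a formal power series in the infinitely many commuting variables $t_1,t_2,\dots$ (arbitrary formal, possibly infinite, linear combinations of monomials). The ring of such power series (over the integers or the rationals) is an integral domain, and $G$ and $H$ are defined a priori as elements of its field of fractions. -}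

module Defs where

open import Algebra.Bundles using (RawRing)
import Algebra.Definitions.RawSemiring as RawSemiringDefs
open import Data.Integer as ℤ using (ℤ; +_; 0ℤ; 1ℤ; -1ℤ)
import Data.Integer.Properties as ℤ
open import Data.List using (List; []; _∷_; _∷ʳ_; foldr; length; map; replicate; _++_)
open import Data.List.Membership.Propositional using (_∈_)
open import Data.List.Properties using (++-identityʳ; length-++; length-replicate; ++-assoc)
open import Data.List.Relation.Unary.All using (All; []; _∷_)
open import Data.List.Relation.Unary.AllPairs using ([]; _∷_)
open import Data.List.Relation.Unary.Any using (here)
open import Data.List.Relation.Unary.Unique.Propositional using (Unique)
open import Data.Nat as ℕ using (ℕ; zero; suc; z≤n; s≤s)
open import Data.Nat.Induction using (<-rec)
import Data.Nat.Properties as ℕ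
open import Data.Product using (Σ; Σ-syntax; ∃-syntax; _×_; _,_)
open import Data.Sum using (_⊎_; inj₁; inj₂)
open import Function using (_∘_)
open import Level using (0ℓ)
open import Relation.Binary.PropositionalEquality
  using (_≡_; _≢_; refl; sym; trans; cong; cong₂)
open import Relation.Nullary using (¬_; contradiction)
open import Relation.Nullary.Decidable using (decidable-stable)

------------------------------------------------------------------------
-- Formal power series in t₁, t₂, … over ℤ

-- The list e₁ ∷ … ∷ eₖ ∷ [] stands for t₁^e₁ ⋯ tₖ^eₖ.  Lists that
-- differ by trailing zeros stand for the same monomial; `padding` makes
-- a series a function of the monomial.

Monomial : Set
Monomial = List ℕ

record Series : Set where
  field
    coeff   : Monomial → ℤ
    padding : ∀ e → coeff (e ∷ʳ 0) ≡ coeff e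

open Series public

infix 4 _≈_ _≉_

record _≈_ (f g : Series) : Set where
  constructor mk≈
  field
    coeff-≡ : ∀ e → coeff f e ≡ coeff g e

open _≈_ public

_≉_ : Series → Series → Set
f ≉ g = ¬ (f ≈ g)

-- antidiagonal n h is the sum of h i j over all i, j with i + j = n.

antidiagonal : ℕ → (ℕ → ℕ → ℤ) → ℤ
antidiagonal zero    h = h 0 0
antidiagonal (suc n) h = h 0 (suc n) ℤ.+ antidiagonal n (λ i j → h (suc i) j)

antidiagonal-cong : ∀ n {h k : ℕ → ℕ → ℤ} → (∀ i j → h i j ≡ k i j) →
                    antidiagonal n h ≡ antidiagonal n k
antidiagonal-cong zero    eq = eq 0 0
antidiagonal-cong (suc n) eq =
  cong₂ ℤ._+_ (eq 0 (suc n)) (antidiagonal-cong n (λ i j → eq (suc i) j))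

-- convolve f g e is the sum of f a · g b over all pairs of exponent
-- vectors a, b of the same length as e with a + b = e.

convolve : (f g : Monomial → ℤ) → Monomial → ℤ
convolve f g []      = f [] ℤ.* g []
convolve f g (n ∷ e) =
  antidiagonal n (λ i j → convolve (f ∘ (i ∷_)) (g ∘ (j ∷_)) e)

convolve-padding : ∀ e {f g : Monomial → ℤ} →
                   (∀ e → f (e ∷ʳ 0) ≡ f e) → (∀ e → g (e ∷ʳ 0) ≡ g e) →
                   convolve f g (e ∷ʳ 0) ≡ convolve f g e
convolve-padding []      pf pg = cong₂ ℤ._*_ (pf []) (pg [])
convolve-padding (n ∷ e) pf pg = antidiagonal-cong n λ i j →
  convolve-padding e (pf ∘ (i ∷_)) (pg ∘ (j ∷_))

one-coeff : Monomial → ℤ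
one-coeff []          = 1ℤ
one-coeff (zero  ∷ e) = one-coeff e
one-coeff (suc _ ∷ e) = 0ℤ

one-padding : ∀ e → one-coeff (e ∷ʳ 0) ≡ one-coeff e
one-padding []          = refl
one-padding (zero  ∷ e) = one-padding e
one-padding (suc _ ∷ e) = refl

var-coeff : ℕ → Monomial → ℤ
var-coeff n       []                = 0ℤ
var-coeff zero    (zero        ∷ e) = 0ℤ
var-coeff zero    (suc zero    ∷ e) = one-coeff e
var-coeff zero    (suc (suc _) ∷ e) = 0ℤ
var-coeff (suc n) (zero        ∷ e) = var-coeff n e
var-coeff (suc n) (suc _       ∷ e) = 0ℤ

var-padding : ∀ n e → var-coeff n (e ∷ʳ 0) ≡ var-coeff n e
var-padding zero    []                = refl
var-padding (suc n) []                = refl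
var-padding zero    (zero        ∷ e) = refl
var-padding zero    (suc zero    ∷ e) = one-padding e
var-padding zero    (suc (suc _) ∷ e) = refl
var-padding (suc n) (zero        ∷ e) = var-padding n e
var-padding (suc n) (suc _       ∷ e) = refl

infixl 6 _+_ _-_
infixl 7 _*_
infix  8 -_

_+_ : Series → Series → Series
coeff   (f + g) e = coeff f e ℤ.+ coeff g e
padding (f + g) e = cong₂ ℤ._+_ (padding f e) (padding g e)

-_ : Series → Series
coeff   (- f) e = ℤ.- coeff f e
padding (- f) e = cong ℤ.-_ (padding f e)

_-_ : Series → Series → Series
f - g = f + - g

_*_ : Series → Series → Series
coeff   (f * g)   = convolve (coeff f) (coeff g)
padding (f * g) e = convolve-padding e (padding f) (padding g)

0# 1# : Series
coeff   0# e = 0ℤ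
padding 0# e = refl
coeff   1#   = one-coeff
padding 1#   = one-padding

-- t+1 n is the variable tₙ₊₁.

t+1 : ℕ → Series
coeff   (t+1 n) = var-coeff n
padding (t+1 n) = var-padding n

seriesRawRing : RawRing 0ℓ 0ℓ
seriesRawRing = record
  { Carrier = Series ; _≈_ = _≈_ ; _+_ = _+_ ; _*_ = _*_ ; -_ = -_ ; 0# = 0# ; 1# = 1# }

open RawSemiringDefs (RawRing.rawSemiring seriesRawRing) public using (_^_)

------------------------------------------------------------------------
-- Infinite sums

Σℤ : {I : Set} → List I → (I → ℤ) → ℤ
Σℤ is a = foldr ℤ._+_ 0ℤ (map a is)

-- HasSum f s: each monomial occurs in only finitely many of the series
-- f i, and s is their coefficientwise sum.

HasSum : {I : Set} → (I → Series) → Series → Set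
HasSum {I} f s = ∀ e → Σ[ is ∈ List I ]
  Unique is ×
  (∀ i → coeff (f i) e ≢ 0ℤ → i ∈ is) ×
  coeff s e ≡ Σℤ is (λ i → coeff (f i) e)

------------------------------------------------------------------------
-- The series form an integral domain

-- On exponent vectors of a fixed length, compare the lexicographically
-- least monomials occurring in two nonzero series.  Since the goal is
-- ⊥, these may be assumed to exist.

private
  Vanishes : ℕ → (Monomial → ℤ) → Set
  Vanishes n f = ∀ e → length e ≡ n → f e ≡ 0ℤ

  antidiagonal-zero : ∀ n {h} → (∀ i j → j ℕ.≤ n → h i j ≡ 0ℤ) → antidiagonal n h ≡ 0ℤ
  antidiagonal-zero zero    z = z 0 0 z≤n
  antidiagonal-zero (suc n) z =
    cong₂ ℤ._+_ (z 0 (suc n) ℕ.≤-refl)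
                (antidiagonal-zero n (λ i j j≤n → z (suc i) j (ℕ.m≤n⇒m≤1+n j≤n)))

  antidiagonal-single : ∀ m n {h} →
    (∀ i j → i ℕ.< m → h i j ≡ 0ℤ) → (∀ i j → j ℕ.< n → h i j ≡ 0ℤ) →
    antidiagonal (m ℕ.+ n) h ≡ h m n
  antidiagonal-single zero    zero    p q = refl
  antidiagonal-single zero    (suc n) {h} p q =
    trans (cong (λ z → h 0 (suc n) ℤ.+ z)
                (antidiagonal-zero n (λ i j j≤n → q (suc i) j (s≤s j≤n))))
          (ℤ.+-identityʳ _)
  antidiagonal-single (suc m) n       p q =
    trans (cong₂ ℤ._+_ (p 0 _ (s≤s z≤n))
            (antidiagonal-single m n (λ i j i<m → p (suc i) j (s≤s i<m)) (λ i → q (suc i))))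
          (ℤ.+-identityˡ _)

  convolve-vanishesˡ : ∀ n {f g} → Vanishes n f → Vanishes n (convolve f g)
  convolve-vanishesˡ zero    {g = g} v []      refl = cong (ℤ._* g []) (v [] refl)
  convolve-vanishesˡ (suc n) v (k ∷ e) eq = antidiagonal-zero k λ i j _ →
    convolve-vanishesˡ n (λ e′ eq′ → v (i ∷ e′) (cong suc eq′)) e (ℕ.suc-injective eq)

  convolve-vanishesʳ : ∀ n {f g} → Vanishes n g → Vanishes n (convolve f g)
  convolve-vanishesʳ zero    {f} v []      refl =
    trans (cong (f [] ℤ.*_) (v [] refl)) (ℤ.*-zeroʳ (f []))
  convolve-vanishesʳ (suc n) v (k ∷ e) eq = antidiagonal-zero k λ i j _ →
    convolve-vanishesʳ n (λ e′ eq′ → v (j ∷ e′) (cong suc eq′)) e (ℕ.suc-injective eq)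

  Vanishes-stable : ∀ n f → ¬ ¬ Vanishes n f → Vanishes n f
  Vanishes-stable n f ¬¬v e eq =
    decidable-stable (f e ℤ.≟ 0ℤ) (λ fe≢0 → ¬¬v (λ v → fe≢0 (v e eq)))

  least : {P : ℕ → Set} → (∀ n → ¬ ¬ P n → P n) → ¬ (∀ n → P n) →
          ¬ (∀ m → (∀ i → i ℕ.< m → P i) → ¬ ¬ P m)
  least {P} stable ¬all k =
    ¬all (<-rec P (λ m below → stable m (k m (λ i i<m → below i<m))))

  least-slice : ∀ n f → ¬ Vanishes (suc n) f →
    ¬ (∀ m → (∀ i → i ℕ.< m → Vanishes n (f ∘ (i ∷_))) → ¬ ¬ Vanishes n (f ∘ (m ∷_)))
  least-slice n f ¬v = least (λ i → Vanishes-stable n (f ∘ (i ∷_)))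
    (λ all → ¬v λ { (i ∷ e) eq → all i e (ℕ.suc-injective eq) })

  convolve-nonvanishing : ∀ n f g → Vanishes n (convolve f g) →
                          ¬ Vanishes n f → ¬ ¬ Vanishes n g
  convolve-nonvanishing zero f g v ¬f ¬g with ℤ.i*j≡0⇒i≡0∨j≡0 (f []) (v [] refl)
  ... | inj₁ f≡0 = ¬f λ { [] refl → f≡0 }
  ... | inj₂ g≡0 = ¬g λ { [] refl → g≡0 }
  convolve-nonvanishing (suc n) f g v ¬f ¬g =
    least-slice n f ¬f λ a below-a ¬fa →
    least-slice n g ¬g λ b below-b ¬gb →
    convolve-nonvanishing n (f ∘ (a ∷_)) (g ∘ (b ∷_))
      (λ e eq → trans
        (sym (antidiagonal-single a b
          (λ i j i<a → convolve-vanishesˡ n (below-a i i<a) e eq)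
          (λ i j j<b → convolve-vanishesʳ n (below-b j j<b) e eq)))
        (v (a ℕ.+ b ∷ e) (cong suc eq)))
      ¬fa ¬gb

  padding-replicate : ∀ (f : Series) k e → coeff f (e ++ replicate k 0) ≡ coeff f e
  padding-replicate f zero    e = cong (coeff f) (++-identityʳ e)
  padding-replicate f (suc k) e =
    trans (cong (coeff f) (sym (++-assoc e (0 ∷ []) (replicate k 0))))
          (trans (padding-replicate f k (e ∷ʳ 0)) (padding f e))

  vanishes-≤ : ∀ (f : Series) {n} e → length e ℕ.≤ n → Vanishes n (coeff f) → coeff f e ≡ 0ℤ
  vanishes-≤ f {n} e le v = trans (sym (padding-replicate f k e))
    (v (e ++ replicate k 0)
       (trans (length-++ e)
         (trans (cong (length e ℕ.+_) (length-replicate k)) (ℕ.m+[n∸m]≡n le))))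
    where k = n ℕ.∸ length e

  nonzero : ∀ (f : Series) → f ≉ 0# → ¬ (∀ e → ¬ coeff f e ≢ 0ℤ)
  nonzero f f≉0 k = f≉0 (mk≈ λ e → decidable-stable (coeff f e ℤ.≟ 0ℤ) (k e))

*-nonzero : ∀ {f g} → f ≉ 0# → g ≉ 0# → f * g ≉ 0#
*-nonzero {f} {g} f≉0 g≉0 fg≈0 =
  nonzero f f≉0 λ a fa≢0 →
  nonzero g g≉0 λ b gb≢0 →
  convolve-nonvanishing (length a ℕ.⊔ length b) (coeff f) (coeff g)
    (λ e _ → coeff-≡ fg≈0 e)
    (λ v → fa≢0 (vanishes-≤ f a (ℕ.m≤m⊔n (length a) (length b)) v))
    (λ v → gb≢0 (vanishes-≤ g b (ℕ.m≤n⊔m (length a) (length b)) v))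

1≉0 : 1# ≉ 0#
1≉0 eq with coeff-≡ eq []
... | ()

------------------------------------------------------------------------
-- The field of fractions

record Fraction : Set where
  field
    num   : Series
    den   : Series
    den≉0 : den ≉ 0#

open Fraction public

infix 4 _≈ᶠ_

_≈ᶠ_ : Fraction → Fraction → Set
x ≈ᶠ y = num x * den y ≈ num y * den x

ι : Series → Fraction
num   (ι f) = f
den   (ι f) = 1#
den≉0 (ι f) = 1≉0

divide : (x y : Fraction) → num y ≉ 0# → Fraction
num   (divide x y y≉0) = num x * den y
den   (divide x y y≉0) = den x * num y
den≉0 (divide x y y≉0) = *-nonzero (den≉0 x) y≉0

------------------------------------------------------------------------
-- The series S₁, S and the fractions G, H

S₁-coeff : Monomial → ℤ
S₁-coeff []                = 0ℤ
S₁-coeff (zero        ∷ e) = S₁-coeff e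
S₁-coeff (suc zero    ∷ e) = one-coeff e
S₁-coeff (suc (suc _) ∷ e) = 0ℤ

-- The coefficient of a monomial in S₁ is 1 for a single variable and 0
-- otherwise; S₁-sum identifies S₁ as t₁ + t₂ + ….

S₁ : Series
coeff   S₁ = S₁-coeff
padding S₁ = S₁-padding
  where
  S₁-padding : ∀ e → S₁-coeff (e ∷ʳ 0) ≡ S₁-coeff e
  S₁-padding []                = refl
  S₁-padding (zero        ∷ e) = S₁-padding e
  S₁-padding (suc zero    ∷ e) = one-padding e
  S₁-padding (suc (suc _) ∷ e) = refl

S₁-sum : HasSum t+1 S₁
S₁-sum e with support e
  where
  support : ∀ e → (S₁-coeff e ≡ 0ℤ × ∀ n → var-coeff n e ≡ 0ℤ) ⊎
                  (∃[ n ] S₁-coeff e ≡ var-coeff n e × (∀ m → var-coeff m e ≢ 0ℤ → m ≡ n))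
  support []                = inj₁ (refl , λ _ → refl)
  support (zero        ∷ e) with support e
  ... | inj₁ (s , z)     = inj₁ (s , λ { zero → refl ; (suc n) → z n })
  ... | inj₂ (n , s , u) = inj₂ (suc n , s ,
    λ { zero 0≢0 → contradiction refl 0≢0 ; (suc m) m≢0 → cong suc (u m m≢0) })
  support (suc zero    ∷ e) = inj₂ (0 , refl ,
    λ { zero _ → refl ; (suc m) 0≢0 → contradiction refl 0≢0 })
  support (suc (suc _) ∷ e) = inj₁ (refl , λ { zero → refl ; (suc n) → refl })
... | inj₁ (s , z)     = [] , [] , (λ n n≢0 → contradiction (z n) n≢0) , s
... | inj₂ (n , s , u) = n ∷ [] , [] ∷ [] , (λ m m≢0 → here (u m m≢0)) ,
                         trans s (sym (ℤ.+-identityʳ _))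

S₁≉0 : S₁ ≉ 0#
S₁≉0 eq with coeff-≡ eq (1 ∷ [])
... | ()

-- S = 1 + Σ_{n ≥ 1} tₙ Sⁿ, with n shifted by one.

FunctionalEquation : Series → Set
FunctionalEquation S =
  Σ[ T ∈ Series ] HasSum (λ n → t+1 n * S ^ suc n) T × S ≈ 1# + T

solution≉0 : ∀ {S} → FunctionalEquation S → S ≉ 0#
solution≉0 {S} (T , sum , eq) S≈0 = absurd
  (trans (sym (coeff-≡ S≈0 [])) (trans (coeff-≡ eq []) (cong (λ c → 1ℤ ℤ.+ c) T[]≡0)))
  where
  Σℤ-zero : ∀ is → Σℤ is (λ n → coeff (t+1 n * S ^ suc n) []) ≡ 0ℤ
  Σℤ-zero []       = refl
  Σℤ-zero (i ∷ is) = trans (ℤ.+-identityˡ _) (Σℤ-zero is)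

  T[]≡0 : coeff T [] ≡ 0ℤ
  T[]≡0 with sum []
  ... | is , _ , _ , s = trans s (Σℤ-zero is)

  absurd : ¬ 0ℤ ≡ 1ℤ
  absurd ()

G : Series → Fraction
G S = divide (ι (S - 1#)) (ι S₁) S₁≉0

H : (S : Series) → FunctionalEquation S → Fraction
H S S-eq = divide (G S) (ι S) (solution≉0 S-eq)

------------------------------------------------------------------------
-- Paths

data Step : Set where
  down : Step
  up   : ℕ → Step

-- `up 0` is the level step 0.

stepValue : Step → ℤ
stepValue down   = -1ℤ
stepValue (up n) = + n

Path : Set
Path = List Step

-- The sums a + s₁ + ⋯ + sᵢ for 1 ≤ i ≤ k.

partialSums : ℤ → Path → List ℤ
partialSums a []      = []
partialSums a (s ∷ p) = a ℤ.+ stepValue s ∷ partialSums (a ℤ.+ stepValue s) p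

Positive : Path → Set
Positive p = All (0ℤ ℤ.<_) (partialSums 0ℤ p)

-- Proofs of Positive p are unique, so each positive path occurs once.

PositivePath : Set
PositivePath = Σ Path Positive

stepWeight : Step → Series
stepWeight down   = 1#
stepWeight (up n) = t+1 n

weight : Path → Series
weight p = foldr _*_ 1# (map stepWeight p)

{-# OPTIONS --safe #-}

-- Let M h be the generating function for the paths started at height h
-- all of whose heights, h included, are positive.  Removing the first
-- step gives M 0 = 0,
--   M (h + 1) = 1 + M h + Σₙ tₙ₊₁ M (h + 1 + n),
-- and P = 1 + Σₙ tₙ₊₁ M n for the positive paths from 0.  The operator
-- behind this recursion is contractive for the total degree, so its
-- fixed point is unique.  Now M h · S₁S and S^(h+1) − S are both fixed
-- points of the same recursion with S₁S in place of 1, because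
-- S^(h+2) = S^(h+1) + Σₙ tₙ₊₁ S^(h+n+2).  Hence they agree, and
--   P · S₁S = Σₙ tₙ₊₁ S + Σₙ tₙ₊₁ (S^(n+1) − S) = S − 1.

module Submission where

open import Defs
open import Algebra.Bundles using (Ring)
import Algebra.Properties.Semiring.Exp
import Algebra.Properties.AbelianGroup
import Algebra.Properties.CommutativeSemigroup
open import Data.Integer as ℤ using (ℤ; +_; 0ℤ; -1ℤ)
import Data.Integer.Properties as ℤ
open import Data.List using (List; []; _∷_; _∷ʳ_; _++_; map; filter; foldr)
open import Data.List.Membership.Propositional using (_∈_)
open import Data.List.Membership.Propositional.Properties
  using (∈-map⁺; ∈-map⁻; ∈-++⁺ˡ; ∈-++⁺ʳ; ∈-filter⁺; ∈-filter⁻)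
open import Data.List.Membership.Propositional.Properties.WithK using (unique∧set⇒bag)
open import Data.List.Properties using (map-∘)
open import Data.List.Relation.Binary.BagAndSetEquality using (∼bag⇒↭)
open import Data.List.Relation.Binary.Permutation.Propositional as ↭ using (_↭_)
open import Data.List.Relation.Unary.All using (All; []; _∷_)
open import Data.List.Relation.Unary.AllPairs using ([]; _∷_)
open import Data.List.Relation.Unary.Any using (here)
open import Data.List.Relation.Unary.Unique.Propositional using (Unique)
import Data.List.Relation.Unary.Unique.Propositional.Properties as Unique
open import Data.Nat as ℕ using (ℕ; zero; suc; z≤n; s≤s)
open import Data.Nat.ListAction using (sum)
import Data.Nat.Properties as ℕ
open import Data.Product using (Σ; Σ-syntax; _×_; _,_; proj₁; proj₂; ∃!)
open import Data.Sum using (_⊎_; inj₁; inj₂)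
open import Data.Sum.Properties using (inj₁-injective; inj₂-injective)
open import Data.Unit using (⊤; tt)
open import Function using (_∘_; id; _↔_; Inverse; mk↔ₛ′; mk⇔)
open import Level using (0ℓ)
import Relation.Binary.Reasoning.Setoid
open import Relation.Binary.PropositionalEquality
  using (_≡_; _≢_; refl; sym; trans; cong; cong₂; subst; module ≡-Reasoning)
open import Relation.Nullary using (¬_; ¬?; yes; no; contradiction)

open Algebra.Properties.CommutativeSemigroup ℤ.+-commutativeSemigroup
  using (interchange; x∙yz≈y∙xz)

-- Finite sums over arbitrary types

-- `HasSum` at a fixed monomial unfolds to this, so infinite sums of series can be handled one
-- coefficient at a time.
Sums : {I : Set} → (I → ℤ) → ℤ → Set
Sums {I} f c = Σ[ is ∈ List I ]
  Unique is ×
  (∀ i → f i ≢ 0ℤ → i ∈ is) ×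
  c ≡ Σℤ is f

module _ {I : Set} where

  Σℤ-cong : ∀ {f g : I → ℤ} → (∀ i → f i ≡ g i) → ∀ is → Σℤ is f ≡ Σℤ is g
  Σℤ-cong eq []       = refl
  Σℤ-cong eq (i ∷ is) = cong₂ ℤ._+_ (eq i) (Σℤ-cong eq is)

  Σℤ-++ : ∀ {f : I → ℤ} is js → Σℤ (is ++ js) f ≡ Σℤ is f ℤ.+ Σℤ js f
  Σℤ-++     []       js = sym (ℤ.+-identityˡ _)
  Σℤ-++ {f} (i ∷ is) js =
    trans (cong (ℤ._+_ (f i)) (Σℤ-++ is js)) (sym (ℤ.+-assoc (f i) _ _))

  Σℤ-map : ∀ {J : Set} {f : I → ℤ} (φ : J → I) js → Σℤ (map φ js) f ≡ Σℤ js (f ∘ φ)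
  Σℤ-map φ js = cong (foldr ℤ._+_ 0ℤ) (sym (map-∘ js))

  Σℤ-↭ : ∀ {f : I → ℤ} {is js} → is ↭ js → Σℤ is f ≡ Σℤ js f
  Σℤ-↭ ↭.refl = refl
  Σℤ-↭ {f} (↭.prep i p) = cong (ℤ._+_ (f i)) (Σℤ-↭ p)
  Σℤ-↭ {f} (↭.swap i j p) =
    trans (x∙yz≈y∙xz (f i) (f j) _) (cong (λ z → f j ℤ.+ (f i ℤ.+ z)) (Σℤ-↭ p))
  Σℤ-↭ (↭.trans p q) = trans (Σℤ-↭ p) (Σℤ-↭ q)

  Sums-cong : ∀ {f g : I → ℤ} {c} → (∀ i → f i ≡ g i) → Sums f c → Sums g c
  Sums-cong eq (is , unique , covers , c≡) =
    is , unique , (λ i gi≢0 → covers i (gi≢0 ∘ trans (sym (eq i)))) ,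
    trans c≡ (Σℤ-cong eq is)

  Sums-zero : ∀ {f : I → ℤ} → (∀ i → f i ≡ 0ℤ) → Sums f 0ℤ
  Sums-zero z = [] , [] , (λ i fi≢0 → contradiction (z i) fi≢0) , refl

  module _ (f : I → ℤ) where
    private
      nonzero? = λ i → ¬? (f i ℤ.≟ 0ℤ)

      Σℤ-filter : ∀ is → Σℤ (filter nonzero? is) f ≡ Σℤ is f
      Σℤ-filter []       = refl
      Σℤ-filter (i ∷ is) with f i ℤ.≟ 0ℤ
      ... | yes fi≡0 = trans (Σℤ-filter is)
        (sym (trans (cong (ℤ._+ Σℤ is f) fi≡0) (ℤ.+-identityˡ _)))
      ... | no  fi≢0 = cong (ℤ._+_ (f i)) (Σℤ-filter is)

    -- The two index lists may differ in indices whose term is 0. Once these are filtered out, both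
    -- lists enumerate the support of `f` without repetition, hence are permutations of each other.
    Sums-unique : ∀ {c d} → Sums f c → Sums f d → c ≡ d
    Sums-unique {c} {d} (is , uniqueᵢ , coversᵢ , c≡) (js , uniqueⱼ , coversⱼ , d≡) = begin
      c                         ≡⟨ c≡ ⟩
      Σℤ is f                   ≡⟨ Σℤ-filter is ⟨
      Σℤ (filter nonzero? is) f ≡⟨ Σℤ-↭ (∼bag⇒↭ (unique∧set⇒bag
                                     (Unique.filter⁺ nonzero? uniqueᵢ)
                                     (Unique.filter⁺ nonzero? uniqueⱼ)
                                     (mk⇔ (transfer is coversⱼ) (transfer js coversᵢ)))) ⟩
      Σℤ (filter nonzero? js) f ≡⟨ Σℤ-filter js ⟩
      Σℤ js f                   ≡⟨ d≡ ⟨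
      d                         ∎
      where
      open ≡-Reasoning
      transfer : ∀ ks {ls} → (∀ i → f i ≢ 0ℤ → i ∈ ls) →
                 ∀ {i} → i ∈ filter nonzero? ks → i ∈ filter nonzero? ls
      transfer ks covers {i} i∈ =
        let fi≢0 = proj₂ (∈-filter⁻ nonzero? {xs = ks} i∈)
        in ∈-filter⁺ nonzero? (covers i fi≢0) fi≢0

module _ {I J : Set} where

  Sums-⊎ : ∀ {f : I ⊎ J → ℤ} {c d} →
           Sums (f ∘ inj₁) c → Sums (f ∘ inj₂) d → Sums f (c ℤ.+ d)
  Sums-⊎ (is , uniqueᵢ , coversᵢ , c≡) (js , uniqueⱼ , coversⱼ , d≡) =
    map inj₁ is ++ map inj₂ js ,
    Unique.++⁺ (Unique.map⁺ inj₁-injective uniqueᵢ) (Unique.map⁺ inj₂-injective uniqueⱼ)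
      disjoint ,
    (λ { (inj₁ i) fi≢0 → ∈-++⁺ˡ (∈-map⁺ inj₁ (coversᵢ i fi≢0))
       ; (inj₂ j) fj≢0 → ∈-++⁺ʳ (map inj₁ is) (∈-map⁺ inj₂ (coversⱼ j fj≢0)) }) ,
    trans (cong₂ ℤ._+_ (trans c≡ (sym (Σℤ-map inj₁ is))) (trans d≡ (sym (Σℤ-map inj₂ js))))
          (sym (Σℤ-++ (map inj₁ is) (map inj₂ js)))
    where
    disjoint : ∀ {k} → ¬ (k ∈ map inj₁ is × k ∈ map inj₂ js)
    disjoint (k∈₁ , k∈₂) with ∈-map⁻ inj₁ k∈₁ | ∈-map⁻ inj₂ k∈₂
    ... | _ , _ , refl | _ , _ , ()

  Sums-↔ : ∀ {f : J → ℤ} {c} (I↔J : I ↔ J) → Sums (f ∘ Inverse.to I↔J) c → Sums f c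
  Sums-↔ {f} I↔J (is , unique , covers , c≡) =
    map to is ,
    Unique.map⁺ (λ {i} {j} eq → trans (sym (strictlyInverseʳ i))
                                      (trans (cong from eq) (strictlyInverseʳ j))) unique ,
    (λ j fj≢0 → subst (_∈ map to is) (strictlyInverseˡ j)
      (∈-map⁺ to (covers (from j) (fj≢0 ∘ trans (cong f (sym (strictlyInverseˡ j))))))) ,
    trans c≡ (sym (Σℤ-map to is))
    where open Inverse I↔J

-- Convolution

antidiagonal-cong-≤ : ∀ n {h k : ℕ → ℕ → ℤ} →
  (∀ i j → i ℕ.≤ n → j ℕ.≤ n → h i j ≡ k i j) → antidiagonal n h ≡ antidiagonal n k
antidiagonal-cong-≤ zero    eq = eq 0 0 z≤n z≤n
antidiagonal-cong-≤ (suc n) eq = cong₂ ℤ._+_ (eq 0 (suc n) z≤n ℕ.≤-refl)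
  (antidiagonal-cong-≤ n λ i j i≤n j≤n → eq (suc i) j (s≤s i≤n) (ℕ.m≤n⇒m≤1+n j≤n))

antidiagonal-zero : ∀ n {h : ℕ → ℕ → ℤ} → (∀ i j → h i j ≡ 0ℤ) → antidiagonal n h ≡ 0ℤ
antidiagonal-zero zero    z = z 0 0
antidiagonal-zero (suc n) z =
  cong₂ ℤ._+_ (z 0 (suc n)) (antidiagonal-zero n (λ i j → z (suc i) j))

antidiagonal-+ : ∀ n {h k : ℕ → ℕ → ℤ} →
  antidiagonal n (λ i j → h i j ℤ.+ k i j) ≡ antidiagonal n h ℤ.+ antidiagonal n k
antidiagonal-+ zero            = refl
antidiagonal-+ (suc n) {h} {k} =
  trans (cong (ℤ._+_ (h 0 (suc n) ℤ.+ k 0 (suc n))) (antidiagonal-+ n))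
        (interchange (h 0 (suc n)) (k 0 (suc n)) _ _)

antidiagonal-firstˡ : ∀ n {h : ℕ → ℕ → ℤ} → (∀ i j → h (suc i) j ≡ 0ℤ) →
                      antidiagonal n h ≡ h 0 n
antidiagonal-firstˡ zero        z = refl
antidiagonal-firstˡ (suc n) {h} z =
  trans (cong (ℤ._+_ (h 0 (suc n))) (antidiagonal-zero n z)) (ℤ.+-identityʳ _)

antidiagonal-firstʳ : ∀ n {h : ℕ → ℕ → ℤ} → (∀ i j → h i (suc j) ≡ 0ℤ) →
                      antidiagonal n h ≡ h n 0
antidiagonal-firstʳ zero    z = refl
antidiagonal-firstʳ (suc n) z =
  trans (cong₂ ℤ._+_ (z 0 n) (antidiagonal-firstʳ n (λ i → z (suc i)))) (ℤ.+-identityˡ _)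

antidiagonal-assoc : ∀ n {h : ℕ → ℕ → ℕ → ℤ} →
  antidiagonal n (λ m k → antidiagonal m (λ i j → h i j k)) ≡
  antidiagonal n (λ i m → antidiagonal m (λ j k → h i j k))
antidiagonal-assoc zero        = refl
antidiagonal-assoc (suc n) {h} =
  trans (cong (ℤ._+_ (h 0 0 (suc n)))
          (trans (antidiagonal-+ n)
                 (cong (ℤ._+_ (antidiagonal n (λ m k → h 0 (suc m) k))) (antidiagonal-assoc n))))
        (sym (ℤ.+-assoc (h 0 0 (suc n)) _ _))

-- `sum e` is the total degree. The exponents of a factor are bounded by those of the product, so
-- products respect truncation by degree.
convolve-cong-≤ : ∀ e {f f′ g g′ : Monomial → ℤ} →
  (∀ a → sum a ℕ.≤ sum e → f a ≡ f′ a) → (∀ a → sum a ℕ.≤ sum e → g a ≡ g′ a) →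
  convolve f g e ≡ convolve f′ g′ e
convolve-cong-≤ []      p q = cong₂ ℤ._*_ (p [] z≤n) (q [] z≤n)
convolve-cong-≤ (n ∷ e) p q = antidiagonal-cong-≤ n λ i j i≤n j≤n →
  convolve-cong-≤ e (λ a a≤e → p (i ∷ a) (ℕ.+-mono-≤ i≤n a≤e))
                    (λ a a≤e → q (j ∷ a) (ℕ.+-mono-≤ j≤n a≤e))

convolve-cong : ∀ e {f f′ g g′ : Monomial → ℤ} →
  (∀ a → f a ≡ f′ a) → (∀ a → g a ≡ g′ a) → convolve f g e ≡ convolve f′ g′ e
convolve-cong e p q = convolve-cong-≤ e (λ a _ → p a) (λ a _ → q a)

convolve-zeroˡ : ∀ e {f g : Monomial → ℤ} → (∀ a → f a ≡ 0ℤ) → convolve f g e ≡ 0ℤ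
convolve-zeroˡ []      {g = g} z = cong (ℤ._* g []) (z [])
convolve-zeroˡ (n ∷ e) z = antidiagonal-zero n λ i j → convolve-zeroˡ e (z ∘ (i ∷_))

convolve-zeroʳ : ∀ e {f g : Monomial → ℤ} → (∀ a → g a ≡ 0ℤ) → convolve f g e ≡ 0ℤ
convolve-zeroʳ []      {f} z = trans (cong (f [] ℤ.*_) (z [])) (ℤ.*-zeroʳ (f []))
convolve-zeroʳ (n ∷ e) z = antidiagonal-zero n λ i j → convolve-zeroʳ e (z ∘ (j ∷_))

convolve-identityˡ : ∀ e {f : Monomial → ℤ} → convolve one-coeff f e ≡ f e
convolve-identityˡ []      = ℤ.*-identityˡ _
convolve-identityˡ (n ∷ e) =
  trans (antidiagonal-firstˡ n (λ i j → convolve-zeroˡ e (λ _ → refl)))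
        (convolve-identityˡ e)

convolve-identityʳ : ∀ e {f : Monomial → ℤ} → convolve f one-coeff e ≡ f e
convolve-identityʳ []      = ℤ.*-identityʳ _
convolve-identityʳ (n ∷ e) =
  trans (antidiagonal-firstʳ n (λ i j → convolve-zeroʳ e (λ _ → refl)))
        (convolve-identityʳ e)

convolve-+ˡ : ∀ e {f f′ g : Monomial → ℤ} →
  convolve (λ a → f a ℤ.+ f′ a) g e ≡ convolve f g e ℤ.+ convolve f′ g e
convolve-+ˡ []      {f} {f′} {g} = ℤ.*-distribʳ-+ (g []) (f []) (f′ [])
convolve-+ˡ (n ∷ e) =
  trans (antidiagonal-cong n (λ i j → convolve-+ˡ e)) (antidiagonal-+ n)

convolve-+ʳ : ∀ e {f g g′ : Monomial → ℤ} →
  convolve f (λ a → g a ℤ.+ g′ a) e ≡ convolve f g e ℤ.+ convolve f g′ e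
convolve-+ʳ []      {f} {g} {g′} = ℤ.*-distribˡ-+ (f []) (g []) (g′ [])
convolve-+ʳ (n ∷ e) =
  trans (antidiagonal-cong n (λ i j → convolve-+ʳ e)) (antidiagonal-+ n)

convolve-antidiagonalˡ : ∀ n e {f : ℕ → ℕ → Monomial → ℤ} {g : Monomial → ℤ} →
  convolve (λ a → antidiagonal n (λ i j → f i j a)) g e ≡
  antidiagonal n (λ i j → convolve (f i j) g e)
convolve-antidiagonalˡ zero    e         = refl
convolve-antidiagonalˡ (suc n) e {f} {g} =
  trans (convolve-+ˡ e) (cong (ℤ._+_ (convolve (f 0 (suc n)) g e)) (convolve-antidiagonalˡ n e))

convolve-antidiagonalʳ : ∀ n e {f : Monomial → ℤ} {g : ℕ → ℕ → Monomial → ℤ} →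
  convolve f (λ a → antidiagonal n (λ i j → g i j a)) e ≡
  antidiagonal n (λ i j → convolve f (g i j) e)
convolve-antidiagonalʳ zero    e         = refl
convolve-antidiagonalʳ (suc n) e {f} {g} =
  trans (convolve-+ʳ e) (cong (ℤ._+_ (convolve f (g 0 (suc n)) e)) (convolve-antidiagonalʳ n e))

convolve-assoc : ∀ e {f g h : Monomial → ℤ} →
  convolve (convolve f g) h e ≡ convolve f (convolve g h) e
convolve-assoc []      {f} {g} {h} = ℤ.*-assoc (f []) (g []) (h [])
convolve-assoc (n ∷ e) {f} {g} {h} = begin
  antidiagonal n (λ m k → convolve (λ a → antidiagonal m (λ i j →
    convolve (f ∘ (i ∷_)) (g ∘ (j ∷_)) a)) (h ∘ (k ∷_)) e)
      ≡⟨ antidiagonal-cong n (λ m k → trans (convolve-antidiagonalˡ m e)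
           (antidiagonal-cong m (λ i j → convolve-assoc e))) ⟩
  antidiagonal n (λ m k → antidiagonal m (λ i j →
    convolve (f ∘ (i ∷_)) (convolve (g ∘ (j ∷_)) (h ∘ (k ∷_))) e))
      ≡⟨ antidiagonal-assoc n ⟩
  antidiagonal n (λ i m → antidiagonal m (λ j k →
    convolve (f ∘ (i ∷_)) (convolve (g ∘ (j ∷_)) (h ∘ (k ∷_))) e))
      ≡⟨ antidiagonal-cong n (λ i m → convolve-antidiagonalʳ m e) ⟨
  antidiagonal n (λ i m → convolve (f ∘ (i ∷_)) (λ a → antidiagonal m (λ j k →
    convolve (g ∘ (j ∷_)) (h ∘ (k ∷_)) a)) e) ∎
  where open ≡-Reasoning

-- The ring of formal power series

seriesRing : Ring 0ℓ 0ℓ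
seriesRing = record
  { Carrier = Series ; _≈_ = _≈_ ; _+_ = _+_ ; _*_ = _*_ ; -_ = -_ ; 0# = 0# ; 1# = 1#
  ; isRing = record
    { +-isAbelianGroup = record
      { isGroup = record
        { isMonoid = record
          { isSemigroup = record
            { isMagma = record
              { isEquivalence = record
                { refl  = mk≈ λ e → refl
                ; sym   = λ f≈g → mk≈ λ e → sym (coeff-≡ f≈g e)
                ; trans = λ f≈g g≈h → mk≈ λ e → trans (coeff-≡ f≈g e) (coeff-≡ g≈h e)
                }
              ; ∙-cong = λ f≈f′ g≈g′ → mk≈ λ e → cong₂ ℤ._+_ (coeff-≡ f≈f′ e) (coeff-≡ g≈g′ e)
              }
            ; assoc = λ f g h → mk≈ λ e → ℤ.+-assoc (coeff f e) _ _
            }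
          ; identity = (λ f → mk≈ λ e → ℤ.+-identityˡ _) , (λ f → mk≈ λ e → ℤ.+-identityʳ _)
          }
        ; inverse = (λ f → mk≈ λ e → ℤ.+-inverseˡ (coeff f e)) ,
                    (λ f → mk≈ λ e → ℤ.+-inverseʳ (coeff f e))
        ; ⁻¹-cong = λ f≈g → mk≈ λ e → cong ℤ.-_ (coeff-≡ f≈g e)
        }
      ; comm = λ f g → mk≈ λ e → ℤ.+-comm (coeff f e) _
      }
    ; *-cong = λ f≈f′ g≈g′ → mk≈ λ e → convolve-cong e (coeff-≡ f≈f′) (coeff-≡ g≈g′)
    ; *-assoc = λ f g h → mk≈ λ e → convolve-assoc e
    ; *-identity = (λ f → mk≈ λ e → convolve-identityˡ e) ,
                   (λ f → mk≈ λ e → convolve-identityʳ e)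
    ; distrib = (λ f g h → mk≈ λ e → convolve-+ʳ e) , (λ f g h → mk≈ λ e → convolve-+ˡ e)
    }
  }

-- The series Σₙ tₙ₊₁ aₙ

-- shift n a e is the coefficient of e in tₙ₊₁ a.

shift : ℕ → (Monomial → ℤ) → Monomial → ℤ
shift n       a []          = 0ℤ
shift zero    a (zero  ∷ e) = 0ℤ
shift zero    a (suc k ∷ e) = a (k ∷ e)
shift (suc n) a (k     ∷ e) = shift n (a ∘ (k ∷_)) e

-- A list of k exponents involves only t₁, ..., tₖ, so recursion on the list makes the infinite sum
-- finite for any family `a`. The first exponent accounts for n = 0; the later variables live in the
-- tail.
tsum : (ℕ → Monomial → ℤ) → Monomial → ℤ
tsum a []      = 0ℤ
tsum a (k ∷ e) = shift 0 (a 0) (k ∷ e) ℤ.+ tsum (λ n → a (suc n) ∘ (k ∷_)) e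

convolve-var : ∀ n e {a : Monomial → ℤ} → convolve (var-coeff n) a e ≡ shift n a e
convolve-var n       []          = refl
convolve-var zero    (zero  ∷ e) = convolve-zeroˡ e (λ _ → refl)
convolve-var zero    (suc k ∷ e) =
  trans (cong₂ ℤ._+_ (convolve-zeroˡ e (λ _ → refl))
          (trans (antidiagonal-firstˡ k (λ i j → convolve-zeroˡ e (λ _ → refl)))
                 (convolve-identityˡ e)))
        (ℤ.+-identityˡ _)
convolve-var (suc n) (k     ∷ e) =
  trans (antidiagonal-firstˡ k (λ i j → convolve-zeroˡ e (λ _ → refl))) (convolve-var n e)

shift₀-padding : ∀ k e {a : Monomial → ℤ} → (∀ b → a (b ∷ʳ 0) ≡ a b) →
                 shift 0 a (k ∷ e ∷ʳ 0) ≡ shift 0 a (k ∷ e)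
shift₀-padding zero    e p = refl
shift₀-padding (suc k) e p = p (k ∷ e)

tsum-padding : ∀ e {a : ℕ → Monomial → ℤ} → (∀ n b → a n (b ∷ʳ 0) ≡ a n b) →
               tsum a (e ∷ʳ 0) ≡ tsum a e
tsum-padding []      p = refl
tsum-padding (k ∷ e) p = cong₂ ℤ._+_ (shift₀-padding k e (p 0))
  (tsum-padding e (λ n b → p (suc n) (k ∷ b)))

-- Multiplication by a variable raises the degree, so only coefficients of strictly smaller degree
-- enter. This strictness is the source of all contractivity below.
tsum-cong-< : ∀ e {a b : ℕ → Monomial → ℤ} →
  (∀ n c → sum c ℕ.< sum e → a n c ≡ b n c) → tsum a e ≡ tsum b e
tsum-cong-< []          p = refl
tsum-cong-< (k     ∷ e) p with tsum-cong-< e (λ n c c<e → p (suc n) (k ∷ c) (ℕ.+-monoʳ-< k c<e))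
tsum-cong-< (zero  ∷ e) p | eq = cong (ℤ._+_ 0ℤ) eq
tsum-cong-< (suc k ∷ e) p | eq = cong₂ ℤ._+_ (p 0 (k ∷ e) ℕ.≤-refl) eq

tsum-+ : ∀ e {a b : ℕ → Monomial → ℤ} →
         tsum (λ n c → a n c ℤ.+ b n c) e ≡ tsum a e ℤ.+ tsum b e
tsum-+ []                  = refl
tsum-+ (k ∷ e) {a} {b} =
  trans (cong₂ ℤ._+_ (shift₀-+ k) (tsum-+ e)) (interchange (shift 0 (a 0) (k ∷ e)) _ _ _)
  where
  shift₀-+ : ∀ k → shift 0 (λ c → a 0 c ℤ.+ b 0 c) (k ∷ e) ≡
                   shift 0 (a 0) (k ∷ e) ℤ.+ shift 0 (b 0) (k ∷ e)
  shift₀-+ zero    = refl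
  shift₀-+ (suc k) = refl

tsum-zero : ∀ e {a : ℕ → Monomial → ℤ} → (∀ n c → a n c ≡ 0ℤ) → tsum a e ≡ 0ℤ
tsum-zero []          z = refl
tsum-zero (zero  ∷ e) z = cong (ℤ._+_ 0ℤ) (tsum-zero e (λ n c → z (suc n) (0 ∷ c)))
tsum-zero (suc k ∷ e) z =
  cong₂ ℤ._+_ (z 0 (k ∷ e)) (tsum-zero e (λ n c → z (suc n) (suc k ∷ c)))

antidiagonal-tsum : ∀ n e {a : ℕ → ℕ → ℕ → Monomial → ℤ} →
  antidiagonal n (λ i j → tsum (a i j) e) ≡
  tsum (λ m c → antidiagonal n (λ i j → a i j m c)) e
antidiagonal-tsum zero    e     = refl
antidiagonal-tsum (suc n) e {a} =
  trans (cong (ℤ._+_ (tsum (a 0 (suc n)) e)) (antidiagonal-tsum n e)) (sym (tsum-+ e))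

convolve-shift₀ : ∀ k e {a b : Monomial → ℤ} →
  antidiagonal k (λ i j → convolve (shift 0 a ∘ (i ∷_)) (b ∘ (j ∷_)) e) ≡
  shift 0 (convolve a b) (k ∷ e)
convolve-shift₀ zero    e = convolve-zeroˡ e (λ _ → refl)
convolve-shift₀ (suc k) e =
  trans (cong₂ ℤ._+_ (convolve-zeroˡ e (λ _ → refl)) refl) (ℤ.+-identityˡ _)

convolve-tsum : ∀ e {a : ℕ → Monomial → ℤ} {b : Monomial → ℤ} →
                convolve (tsum a) b e ≡ tsum (λ n → convolve (a n) b) e
convolve-tsum []      = refl
convolve-tsum (k ∷ e) =
  trans (antidiagonal-cong k (λ i j → convolve-+ˡ e))
  (trans (antidiagonal-+ k)
  (cong₂ ℤ._+_ (convolve-shift₀ k e)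
    (trans (antidiagonal-cong k (λ i j → convolve-tsum e)) (antidiagonal-tsum k e))))

tSum : (ℕ → Series) → Series
coeff   (tSum a) e = tsum (coeff ∘ a) e
padding (tSum a) e = tsum-padding e (padding ∘ a)

tSum-cong : ∀ {a b} → (∀ n → a n ≈ b n) → tSum a ≈ tSum b
tSum-cong eq = mk≈ λ e → tsum-cong-< e (λ n c _ → coeff-≡ (eq n) c)

tSum-+ : ∀ a b → tSum (λ n → a n + b n) ≈ tSum a + tSum b
tSum-+ a b = mk≈ λ e → tsum-+ e

tSum-* : ∀ a f → tSum a * f ≈ tSum (λ n → a n * f)
tSum-* a f = mk≈ λ e → convolve-tsum e

S₁≈tSum : S₁ ≈ tSum (λ _ → 1#)
S₁≈tSum = mk≈ S₁-tsum
  where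
  S₁-tsum : ∀ e → S₁-coeff e ≡ tsum (λ _ → one-coeff) e
  S₁-tsum []                = refl
  S₁-tsum (zero        ∷ e) = trans (S₁-tsum e) (sym (ℤ.+-identityˡ _))
  S₁-tsum (suc zero    ∷ e) = sym (trans (cong (ℤ._+_ (one-coeff e)) (tsum-zero e (λ _ _ → refl)))
                                         (ℤ.+-identityʳ _))
  S₁-tsum (suc (suc k) ∷ e) = sym (cong (ℤ._+_ 0ℤ) (tsum-zero e (λ _ _ → refl)))

-- The index type splits into n = 0 and n > 0 along the recursion of `tsum`. Assuming the sums only
-- in degrees below that of `e` is what later allows an induction on the degree.
Σ-Sums-tsum : ∀ e {I : ℕ → Set} {f : ∀ n → I n → Monomial → ℤ} {a : ℕ → Monomial → ℤ} →
  (∀ n b → sum b ℕ.< sum e → Sums (λ i → f n i b) (a n b)) →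
  Sums (λ ((n , i) : Σ ℕ I) → shift n (f n i) e) (tsum a e)
Σ-Sums-tsum []              p = Sums-zero (λ _ → refl)
Σ-Sums-tsum (k ∷ e) {I} {f} {a} p = Sums-↔ split
  (Sums-⊎ (first k p) (Σ-Sums-tsum e λ n b b<e → p (suc n) (k ∷ b) (ℕ.+-monoʳ-< k b<e)))
  where
  first : ∀ k → (∀ n b → sum b ℕ.< sum (k ∷ e) → Sums (λ i → f n i b) (a n b)) →
          Sums (λ i → shift 0 (f 0 i) (k ∷ e)) (shift 0 (a 0) (k ∷ e))
  first zero    p = Sums-zero (λ _ → refl)
  first (suc k) p = p 0 (k ∷ e) ℕ.≤-refl

  split : (I 0 ⊎ Σ ℕ (I ∘ suc)) ↔ Σ ℕ I
  split = mk↔ₛ′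
    (λ { (inj₁ i) → 0 , i ; (inj₂ (n , i)) → suc n , i })
    (λ { (zero , i) → inj₁ i ; (suc n , i) → inj₂ (n , i) })
    (λ { (zero , i) → refl ; (suc n , i) → refl })
    (λ { (inj₁ i) → refl ; (inj₂ (n , i)) → refl })

⊤-Sums : ∀ {f : ⊤ → ℤ} → Sums f (f tt)
⊤-Sums = tt ∷ [] , [] ∷ [] , (λ _ _ → here refl) , sym (ℤ.+-identityʳ _)

tSum-HasSum : ∀ a → HasSum (λ n → t+1 n * a n) (tSum a)
tSum-HasSum a e = Sums-↔ (mk↔ₛ′ proj₁ (_, tt) (λ _ → refl) (λ _ → refl))
  (Sums-cong (λ (n , _) → sym (convolve-var n e)) (Σ-Sums-tsum e (λ n b _ → ⊤-Sums)))

-- Fixed points of operators that are contractive for the total degree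

Below : ℕ → Series → Series → Set
Below d f g = ∀ e → sum e ℕ.< d → coeff f e ≡ coeff g e

Below-* : ∀ {d f f′ g g′} → Below d f f′ → Below d g g′ → Below d (f * g) (f′ * g′)
Below-* p q e e<d = convolve-cong-≤ e (λ a a≤e → p a (ℕ.≤-<-trans a≤e e<d))
                                      (λ a a≤e → q a (ℕ.≤-<-trans a≤e e<d))

Below-^ : ∀ {d f g} → Below d f g → ∀ n → Below d (f ^ n) (g ^ n)
Below-^ p zero            = λ _ _ → refl
Below-^ {f = f} {g} p (suc n) = Below-* {f = f} {g} {f ^ n} {g ^ n} p (Below-^ {f = f} {g} p n)

Below-tSum : ∀ {d a b} → (∀ n → Below d (a n) (b n)) → Below (suc d) (tSum a) (tSum b)
Below-tSum p e e≤d = tsum-cong-< e λ n c c<e → p n c (ℕ.<-≤-trans c<e (ℕ.s≤s⁻¹ e≤d))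

sum-padding : ∀ e → sum (e ∷ʳ 0) ≡ sum e
sum-padding []      = refl
sum-padding (n ∷ e) = cong (n ℕ.+_) (sum-padding e)

module Contraction {I : Set} (Φ : (I → Series) → I → Series)
  (contractive : ∀ {d f g} → (∀ i → Below d (f i) (g i)) → ∀ i → Below (suc d) (Φ f i) (Φ g i))
  where

  iterate : ℕ → I → Series
  iterate zero    = λ _ → 0#
  iterate (suc d) = Φ (iterate d)

  iterate-Below : ∀ {d m} → d ℕ.≤ m → ∀ i → Below d (iterate d i) (iterate m i)
  iterate-Below z≤n       i e ()
  iterate-Below (s≤s d≤m) = contractive (iterate-Below d≤m)

  -- From the d-th on, all iterates agree below degree d, so the coefficient at `e` is final at
  -- index `suc (sum e)`.
  fix : I → Series
  coeff   (fix i) e = coeff (iterate (suc (sum e)) i) e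
  padding (fix i) e = trans (cong (λ d → coeff (iterate (suc d) i) (e ∷ʳ 0)) (sum-padding e))
                            (padding (iterate (suc (sum e)) i) e)

  fix-Below : ∀ d i → Below d (fix i) (iterate d i)
  fix-Below d i e e<d = iterate-Below e<d i e ℕ.≤-refl

  fix-fixed : ∀ i → fix i ≈ Φ fix i
  -- `fix` agrees with `iterate (sum e)` below degree `sum e`; applying `Φ` extends the agreement to
  -- degree `sum e` itself.
  fix-fixed i = mk≈ λ e → sym (contractive (fix-Below (sum e)) i e ℕ.≤-refl)

  fixed-unique : ∀ {f g} → (∀ i → f i ≈ Φ f i) → (∀ i → g i ≈ Φ g i) → ∀ i → f i ≈ g i
  fixed-unique {f} {g} f-fixed g-fixed i = mk≈ λ e → below (suc (sum e)) i e ℕ.≤-refl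
    where
    below : ∀ d i → Below d (f i) (g i)
    below zero    i e ()
    below (suc d) i e e<d = trans (coeff-≡ (f-fixed i) e)
      (trans (contractive (below d) i e e<d) (sym (coeff-≡ (g-fixed i) e)))

-- The series S

-- A single unknown is a family over `⊤`. Powers preserve agreement below a degree and `tSum`
-- extends it by one, so the operator is contractive.
S-operator : (⊤ → Series) → ⊤ → Series
S-operator f tt = 1# + tSum (λ n → f tt ^ suc n)

open Contraction S-operator (λ {d} {f} {g} p i e e<d → cong (ℤ._+_ (one-coeff e))
    (Below-tSum {a = λ n → f tt ^ suc n} {λ n → g tt ^ suc n}
      (λ n → Below-^ {f = f tt} {g tt} (p tt) (suc n)) e e<d))
  using () renaming (fix to S-family; fix-fixed to S-fixed; fixed-unique to S-unique)

-- The witness `T` is an arbitrary series with the required sum; uniqueness of sums identifies it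
-- with the canonical `tSum`.
solution⇒fixed : ∀ {S} → FunctionalEquation S → S ≈ 1# + tSum (λ n → S ^ suc n)
solution⇒fixed {S} (T , T-sum , eq) = mk≈ λ e → trans (coeff-≡ eq e)
  (cong (ℤ._+_ (one-coeff e))
    (Sums-unique (λ n → coeff (t+1 n * S ^ suc n) e) (T-sum e) (tSum-HasSum (λ n → S ^ suc n) e)))

∃!-solution : ∃! _≈_ FunctionalEquation
∃!-solution = S-family tt ,
  (tSum (λ n → S-family tt ^ suc n) , tSum-HasSum (λ n → S-family tt ^ suc n) , S-fixed tt) ,
  λ {S} S-eq → S-unique {S-family} {λ _ → S} S-fixed (λ _ → solution⇒fixed S-eq) tt

-- Paths staying positive from a given height

-- In walk C f (suc h), the downward step recurses into walk itself
-- rather than into f: it does not raise the degree, so walk C would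
-- otherwise not be contractive.

walk : Series → (ℕ → Series) → ℕ → Series
walk C f zero    = 0#
walk C f (suc h) = C + (walk C f h + tSum (λ n → f (suc h ℕ.+ n)))

walk-contractive : ∀ C {d f g} → (∀ h → Below d (f h) (g h)) →
                   ∀ h → Below (suc d) (walk C f h) (walk C g h)
walk-contractive C p zero    e e≤d = refl
walk-contractive C {f = f} {g} p (suc h) e e≤d = cong (ℤ._+_ (coeff C e))
  (cong₂ ℤ._+_ (walk-contractive C {f = f} {g} p h e e≤d)
    (Below-tSum {a = λ n → f (suc h ℕ.+ n)} {λ n → g (suc h ℕ.+ n)}
      (λ n → p (suc h ℕ.+ n)) e e≤d))

module Walk (C : Series) = Contraction (walk C) (λ {d} {f} {g} → walk-contractive C {d} {f} {g})

M : ℕ → Series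
M = Walk.fix 1#

M-fixed : ∀ h → M h ≈ walk 1# M h
M-fixed = Walk.fix-fixed 1#

-- Two versions are kept apart because a positive path starts at height 0, which is not itself
-- positive, while every height reached later must be.
PositiveFrom AlwaysPositiveFrom : ℤ → Set
PositiveFrom       z = Σ[ p ∈ Path ] All (0ℤ ℤ.<_) (partialSums z p)
AlwaysPositiveFrom z = Σ[ p ∈ Path ] All (0ℤ ℤ.<_) (z ∷ partialSums z p)

-- The height after the first step heads the list of partial sums, so the positivity proof of a
-- nonempty path is literally that of its remainder with the starting height included.
firstStep : ∀ z → (⊤ ⊎ (AlwaysPositiveFrom (z ℤ.+ -1ℤ) ⊎
                        Σ[ n ∈ ℕ ] AlwaysPositiveFrom (z ℤ.+ + n))) ↔ PositiveFrom z
firstStep z = mk↔ₛ′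
  (λ { (inj₁ _)                   → [] , []
     ; (inj₂ (inj₁ (p , q)))      → down ∷ p , q
     ; (inj₂ (inj₂ (n , p , q)))  → up n ∷ p , q })
  (λ { ([] , [])       → inj₁ tt
     ; (down ∷ p , q)  → inj₂ (inj₁ (p , q))
     ; (up n ∷ p , q)  → inj₂ (inj₂ (n , p , q)) })
  (λ { ([] , []) → refl ; (down ∷ p , q) → refl ; (up n ∷ p , q) → refl })
  (λ { (inj₁ _) → refl ; (inj₂ (inj₁ (p , q))) → refl ; (inj₂ (inj₂ (n , p , q))) → refl })

-- A down step has weight 1 and keeps the degree, so its sum is needed at `e` itself; an up step
-- carries a variable, so its sums are needed only in smaller degrees.
firstStep-Sums : ∀ z e {c} {a : ℕ → Series} →
  Sums (λ (p : AlwaysPositiveFrom (z ℤ.+ -1ℤ)) → coeff (weight (proj₁ p)) e) c →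
  (∀ n b → sum b ℕ.< sum e →
    Sums (λ (p : AlwaysPositiveFrom (z ℤ.+ + n)) → coeff (weight (proj₁ p)) b) (coeff (a n) b)) →
  Sums (λ (p : PositiveFrom z) → coeff (weight (proj₁ p)) e)
       (one-coeff e ℤ.+ (c ℤ.+ coeff (tSum a) e))
firstStep-Sums z e down-Sums up-Sums = Sums-↔ (firstStep z)
  (Sums-⊎ ⊤-Sums
    (Sums-⊎ (Sums-cong (λ _ → sym (convolve-identityˡ e)) down-Sums)
            (Sums-cong (λ (n , _) → sym (convolve-var n e)) (Σ-Sums-tsum e up-Sums))))

-- Lexicographic induction on the degree bound `d` and the height `h`: a down step keeps `d` and
-- lowers `h`, an up step may raise `h` but lowers `d`.
M-Sums : ∀ d h e → sum e ℕ.< d →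
  Sums (λ (p : AlwaysPositiveFrom (+ h)) → coeff (weight (proj₁ p)) e) (coeff (M h) e)
M-Sums (suc d) zero    e e<d =
  subst (Sums _) (sym (coeff-≡ (M-fixed 0) e)) ([] , [] , (λ { (_ , ℤ.+<+ () ∷ _) }) , refl)
M-Sums (suc d) (suc h) e e<d = subst (Sums _)
  (sym (trans (coeff-≡ (M-fixed (suc h)) e)
    (cong (λ c → one-coeff e ℤ.+ (c ℤ.+ coeff (tSum (λ n → M (suc h ℕ.+ n))) e))
          -- `walk` calls itself at the down step, so `M-fixed h` folds the inner `walk 1# M h` back
          -- into `M h`.
          (sym (coeff-≡ (M-fixed h) e)))))
  -- The starting height is positive, with a unique proof, so adding that proof is a bijection.
  (Sums-↔ (mk↔ₛ′ (λ (p , q) → p , ℤ.+<+ (s≤s z≤n) ∷ q) (λ { (p , _ ∷ q) → p , q })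
                 (λ { (p , ℤ.+<+ (s≤s z≤n) ∷ q) → refl }) (λ _ → refl))
    (firstStep-Sums (+ suc h) e {a = λ n → M (suc h ℕ.+ n)} (M-Sums (suc d) h e e<d)
      (λ n b b<e → M-Sums d (suc h ℕ.+ n) b (ℕ.<-≤-trans b<e (ℕ.s≤s⁻¹ e<d)))))

-- The generating function for positive paths

P : Series
P = 1# + tSum M

P-HasSum : HasSum (λ (p : PositivePath) → weight (proj₁ p)) P
-- A first step down would reach -1, so that branch is empty; the `subst` discards its 0.
P-HasSum e = subst (Sums _) (cong (ℤ._+_ (one-coeff e)) (ℤ.+-identityˡ _))
  (firstStep-Sums (+ 0) e {a = M} ([] , [] , (λ { (_ , () ∷ _) }) , refl)
    (λ n b _ → M-Sums (suc (sum b)) n b ℕ.≤-refl))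

-- The identity P · S₁S = S - 1

module _ (S : Series) (S-fixed : S ≈ 1# + tSum (λ n → S ^ suc n)) where

  open Ring seriesRing hiding (_≈_; _+_; _*_; _-_; -_; 0#; 1#)
    renaming (refl to ≈-refl; sym to ≈-sym; trans to ≈-trans)
  open Algebra.Properties.Semiring.Exp semiring using (^-homo-*; ^-congʳ)
  open Algebra.Properties.AbelianGroup +-abelianGroup using (xyx⁻¹≈y)
  open Relation.Binary.Reasoning.Setoid setoid

  private
    Q : Series
    Q = S₁ * S

    V : ℕ → Series
    V h = S ^ suc h - S

  [f-g]+g≈f : ∀ f g → (f - g) + g ≈ f
  [f-g]+g≈f f g = begin
    (f - g) + g   ≈⟨ +-assoc f (- g) g ⟩
    f + (- g + g) ≈⟨ +-congˡ (-‿inverseˡ g) ⟩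
    f + 0#        ≈⟨ +-identityʳ f ⟩
    f             ∎

  -- Since S₁ = Σₙ tₙ₊₁, the product `Q` is Σₙ tₙ₊₁ S, which restores the S subtracted in each `V`.
  -- The reindexing `φ` serves both the shifted sums in `walk` and, as `id`, the sum in `P`.
  tSum-V+Q : ∀ (φ : ℕ → ℕ) → Q + tSum (λ n → V (φ n)) ≈ tSum (λ n → S ^ suc (φ n))
  tSum-V+Q φ = begin
    S₁ * S + tSum (V ∘ φ)                ≈⟨ +-congʳ (*-congʳ S₁≈tSum) ⟩
    tSum (λ _ → 1#) * S + tSum (V ∘ φ)   ≈⟨ +-congʳ (tSum-* (λ _ → 1#) S) ⟩
    tSum (λ _ → 1# * S) + tSum (V ∘ φ)   ≈⟨ +-congʳ (tSum-cong (λ _ → *-identityˡ S)) ⟩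
    tSum (λ _ → S) + tSum (V ∘ φ)        ≈⟨ +-comm _ _ ⟩
    tSum (V ∘ φ) + tSum (λ _ → S)        ≈⟨ tSum-+ (V ∘ φ) (λ _ → S) ⟨
    tSum (λ n → V (φ n) + S)             ≈⟨ tSum-cong (λ n → [f-g]+g≈f (S ^ suc (φ n)) S) ⟩
    tSum (λ n → S ^ suc (φ n))           ∎

  -- This is the fixed-point equation of S multiplied by `S ^ suc h`.
  ^-step : ∀ h → S ^ suc (suc h) ≈ S ^ suc h + tSum (λ n → S ^ suc (suc h ℕ.+ n))
  ^-step h = begin
    S * S ^ suc h
      ≈⟨ *-congʳ S-fixed ⟩
    (1# + tSum (λ n → S ^ suc n)) * S ^ suc h
      ≈⟨ distribʳ (S ^ suc h) 1# (tSum (λ n → S ^ suc n)) ⟩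
    1# * S ^ suc h + tSum (λ n → S ^ suc n) * S ^ suc h
      ≈⟨ +-cong (*-identityˡ (S ^ suc h)) (tSum-* (λ n → S ^ suc n) (S ^ suc h)) ⟩
    S ^ suc h + tSum (λ n → S ^ suc n * S ^ suc h)
      ≈⟨ +-congˡ {S ^ suc h} (tSum-cong λ n → ≈-trans (≈-sym (^-homo-* S (suc n) (suc h)))
           (^-congʳ S (cong suc (ℕ.+-comm n (suc h))))) ⟩
    S ^ suc h + tSum (λ n → S ^ suc (suc h ℕ.+ n)) ∎

  -- At height 0 both sides vanish. Otherwise S is subtracted from `^-step`: the power `S ^ suc h`
  -- absorbs it to form `V h`, and `tSum-V+Q` rewrites the remaining sum.
  V-fixed : ∀ h → V h ≈ walk Q V h
  V-fixed zero    = ≈-trans (+-congʳ (*-identityʳ S)) (-‿inverseʳ S)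
  V-fixed (suc h) = begin
    S ^ suc (suc h) - S                       ≈⟨ +-congʳ (^-step h) ⟩
    (S ^ suc h + X) - S                       ≈⟨ +-assoc _ _ _ ⟩
    S ^ suc h + (X - S)                       ≈⟨ +-congˡ (+-comm X (- S)) ⟩
    S ^ suc h + (- S + X)                     ≈⟨ +-assoc _ _ _ ⟨
    -- The induction hypothesis expands `V h`, because the recursive slot of `walk` holds
    -- `walk Q V h`.
    V h + X                                   ≈⟨ +-cong (V-fixed h) (≈-sym (tSum-V+Q (suc h ℕ.+_))) ⟩
    walk Q V h + (Q + Y)                      ≈⟨ +-assoc _ _ _ ⟨
    (walk Q V h + Q) + Y                      ≈⟨ +-congʳ (+-comm _ Q) ⟩
    (Q + walk Q V h) + Y                      ≈⟨ +-assoc _ _ _ ⟩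
    Q + (walk Q V h + Y)                      ∎
    where
    X = tSum (λ n → S ^ suc (suc h ℕ.+ n))
    Y = tSum (λ n → V (suc h ℕ.+ n))

  -- Multiplication by `g` is additive and commutes with `tSum`, so only the constant changes, from
  -- 1 to `g`. Hence the family `M h * Q` is a fixed point of the recursion with constant `Q`.
  walk-* : ∀ f g h → walk 1# f h * g ≈ walk g (λ h → f h * g) h
  walk-* f g zero    = zeroˡ g
  walk-* f g (suc h) = begin
    (1# + (walk 1# f h + X)) * g           ≈⟨ distribʳ g 1# _ ⟩
    1# * g + (walk 1# f h + X) * g         ≈⟨ +-cong (*-identityˡ g) (distribʳ g (walk 1# f h) X) ⟩
    g + (walk 1# f h * g + X * g)          ≈⟨ +-congˡ (+-cong (walk-* f g h) (tSum-* _ g)) ⟩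
    walk g (λ h → f h * g) (suc h)         ∎
    where X = tSum (λ n → f (suc h ℕ.+ n))

  M*Q≈V : ∀ h → M h * Q ≈ V h
  M*Q≈V = Walk.fixed-unique Q (λ h → ≈-trans (*-congʳ (M-fixed h)) (walk-* M Q h)) V-fixed

  P*Q≈S-1 : P * Q ≈ S - 1#
  P*Q≈S-1 = begin
    (1# + tSum M) * Q          ≈⟨ distribʳ Q 1# (tSum M) ⟩
    1# * Q + tSum M * Q        ≈⟨ +-cong (*-identityˡ Q) (tSum-* M Q) ⟩
    Q + tSum (λ n → M n * Q)   ≈⟨ +-congˡ (tSum-cong M*Q≈V) ⟩
    Q + tSum V                 ≈⟨ tSum-V+Q id ⟩
    tSum (λ n → S ^ suc n)     ≈⟨ xyx⁻¹≈y 1# _ ⟨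
    1# + tSum (λ n → S ^ suc n) - 1# ≈⟨ +-congʳ S-fixed ⟨
    S - 1#                     ∎

  -- The cross-multiplied equation to which `H S S-eq ≈ᶠ ι P` unfolds; the factors `1#` are the
  -- denominators of the series embedded by `ι`.
  quotient≈P : ((S - 1#) * 1#) * 1# * 1# ≈ P * ((1# * S₁) * S)
  quotient≈P = begin
    ((S - 1#) * 1#) * 1# * 1# ≈⟨ *-identityʳ _ ⟩
    ((S - 1#) * 1#) * 1#      ≈⟨ *-identityʳ _ ⟩
    (S - 1#) * 1#             ≈⟨ *-identityʳ _ ⟩
    S - 1#                    ≈⟨ P*Q≈S-1 ⟨
    P * (S₁ * S)              ≈⟨ *-congˡ (*-congʳ (*-identityˡ S₁)) ⟨
    P * ((1# * S₁) * S)       ∎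

theorem3p5 : ∃! _≈_ FunctionalEquation ×
    ((S : Series) (S-eq : FunctionalEquation S) →
    Σ[ P ∈ Series ]
    HasSum (λ (p : PositivePath) → weight (proj₁ p)) P ×
    H S S-eq ≈ᶠ ι P)
theorem3p5 = ∃!-solution , λ S S-eq → P , P-HasSum , quotient≈P S (solution⇒fixed S-eq)
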